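{- Every longest cycle of a $2$-connected $\{P_4,W\}$-free graph is a dominating cycle of that graph.
   Context: All graphs are finite and simple. A cycle $C$ in a graph $G$ is dominating if every edge of $G$ has at least one end vertex on $C$. $G$ is $\{P_4,W\}$-free if it contains neither $P_4$ (the path on $4$ vertices) nor $W$ as an induced subgraph, where $W=K_1+3K_2$ is the graph consisting of a vertex joined to all six vertices of three pairwise disjoint edges. -}

module Defs where

open import Data.Nat using (ℕ; zero; suc; _≤_; _<_)
open import Data.Bool using (Bool; true; false; _∨_; T)
open import Data.Bool.Properties using () renaming (_≟_ to _≟ᵇ_)
open import Data.Fin using (Fin; toℕ) renaming (zero to fz; suc to fs)
open import Data.Fin.Properties using (all?)
open import Data.Product using (Σ; ∃; _×_; _,_)
open import Data.Sum using (_⊎_)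
open import Data.Unit using (⊤)
open import Relation.Nullary using (¬_)
open import Relation.Nullary.Decidable using (toWitness)
open import Relation.Binary.PropositionalEquality using (_≡_; _≢_)
open import Function.Definitions using (Injective)

record Graph : Set where
  field
    n     : ℕ
    adj   : Fin n → Fin n → Bool
    sym   : ∀ u v → adj u v ≡ adj v u
    irrfl : ∀ u → adj u u ≡ false

open Graph public

Vertex : Graph → Set
Vertex G = Fin (n G)

Adj : (G : Graph) → Vertex G → Vertex G → Set
Adj G u v = T (adj G u v)

data Walk (G : Graph) (ok : Vertex G → Set) : Vertex G → Vertex G → Set where
  here : ∀ {u} → ok u → Walk G ok u u
  step : ∀ {u w v} → ok u → Adj G u w → Walk G ok w v → Walk G ok u v

Connected : Graph → Set
Connected G = ∀ u v → Walk G (λ _ → ⊤) u v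

TwoConnected : Graph → Set
TwoConnected G =
  (3 ≤ n G) × Connected G ×
  (∀ x u v → u ≢ x → v ≢ x → Walk G (λ w → w ≢ x) u v)

InducedSub : Graph → Graph → Set
InducedSub H G =
  Σ (Vertex H → Vertex G) λ f →
    Injective _≡_ _≡_ f × (∀ u v → adj H u v ≡ adj G (f u) (f v))

next : ∀ {m} → Fin (suc m) → Fin (suc m)
next {m} i with Data.Nat._<?_ (suc (toℕ i)) (suc m)
... | Relation.Nullary.yes p = Data.Fin.fromℕ< p
... | Relation.Nullary.no _ = fz

record Cycle (G : Graph) : Set where
  field
    m        : ℕ
    len≥3    : 3 ≤ suc m
    vert     : Fin (suc m) → Vertex G
    distinct : Injective _≡_ _≡_ vert
    closed   : ∀ i → Adj G (vert i) (vert (next i))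

open Cycle public

len : {G : Graph} → Cycle G → ℕ
len C = suc (m C)

OnCycle : {G : Graph} → Vertex G → Cycle G → Set
OnCycle v C = ∃ λ i → vert C i ≡ v

LongestCycle : (G : Graph) → Cycle G → Set
LongestCycle G C = ∀ (D : Cycle G) → len D ≤ len C

Dominating : (G : Graph) → Cycle G → Set
Dominating G C = ∀ u v → Adj G u v → OnCycle u C ⊎ OnCycle v C

eP4 : ℕ → ℕ → Bool
eP4 0 1 = true
eP4 1 2 = true
eP4 2 3 = true
eP4 _ _ = false

-- W = K1 + 3K2: centre 0 joined to 1..6, edges 12, 34, 56.
eW : ℕ → ℕ → Bool
eW 0 (suc _) = true
eW 1 2 = true
eW 3 4 = true
eW 5 6 = true
eW _ _ = false

symAdj : (k : ℕ) → (ℕ → ℕ → Bool) → Fin k → Fin k → Bool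
symAdj k e i j = e (toℕ i) (toℕ j) ∨ e (toℕ j) (toℕ i)

P4 : Graph
P4 = record
  { n = 4
  ; adj = symAdj 4 eP4
  ; sym = λ u v → toWitness {a? = all? λ i → all? λ j → symAdj 4 eP4 i j ≟ᵇ symAdj 4 eP4 j i} _ u v
  ; irrfl = λ u → toWitness {a? = all? λ i → symAdj 4 eP4 i i ≟ᵇ false} _ u
  }

W : Graph
W = record
  { n = 7
  ; adj = symAdj 7 eW
  ; sym = λ u v → toWitness {a? = all? λ i → all? λ j → symAdj 7 eW i j ≟ᵇ symAdj 7 eW j i} _ u v
  ; irrfl = λ u → toWitness {a? = all? λ i → symAdj 7 eW i i ≟ᵇ false} _ u
  }

P4WFree : Graph → Set
P4WFree G = ¬ InducedSub P4 G × ¬ InducedSub W G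

-- Suppose an edge uv misses the longest cycle C.  Detours through u and v, together with
-- P₄-freeness, show that a vertex x of C adjacent to u is also adjacent to v; by
-- 2-connectedness there are two such vertices x ≠ y.  Let x₁, x₂ and y₁, y₂ be the next two
-- vertices after x and y on C.  None of these four is adjacent to u or v, and none of
-- x₁y₁, x₁y₂, x₂y₁ is an edge, since otherwise C could be lengthened.  By P₄-freeness
-- x ~ y₁ or y ~ x₁; by symmetry assume the former.  P₄-freeness then gives x ~ x₂, x ~ y₂ and
-- x₂ ≁ y₂, so x together with the edges uv, x₁x₂, y₁y₂ induces W.
module Submission where

open import Defs
open import Data.Bool using (true; false; T)
open import Data.Bool.Properties using (T?; T-≡) renaming (_≟_ to _≟ᵇ_)
open import Data.Fin using (Fin; toℕ; inject₁; fromℕ) renaming (zero to fz; suc to fs)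
import Data.Fin.Properties as Fin
open import Data.Fin.Relation.Unary.Top using (view; ‵fromℕ; ‵inj₁)
open import Data.List using (List; []; _∷_; _++_; length; lookup; tabulate)
open import Data.List.Membership.Propositional using (_∈_)
open import Data.List.Membership.Propositional.Properties using (∈-tabulate⁺; ∈-tabulate⁻; ∈-allFin; ∈-lookup; ∈-++⁺ʳ)
open import Data.List.Properties using (length-++; length-tabulate)
open import Data.List.Relation.Binary.Disjoint.Propositional using (Disjoint)
open import Data.List.Relation.Binary.Permutation.Propositional using (_↭_; ↭-refl; ↭-sym; ↭-trans; ↭-reflexive; prep; ↭⇒↭ₛ)
open import Data.List.Relation.Binary.Permutation.Propositional.Properties using (∈-resp-↭; ↭-length; ++⁺ʳ; ++⁺ˡ; ++-comm; shift)
import Data.List.Relation.Binary.Permutation.Setoid.Properties as Permutationₛ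
open import Data.List.Relation.Unary.All as All using (All; []; _∷_)
open import Data.List.Relation.Unary.AllPairs using (AllPairs; []; _∷_)
open import Data.List.Relation.Unary.Any using (here; there)
open import Data.List.Relation.Unary.Unique.Propositional using (Unique)
import Data.List.Relation.Unary.Unique.Propositional.Properties as Unique
open import Data.Nat using (zero; suc; _+_; _≤_; _<_; z≤n; s≤s; _≤?_; _<?_)
open import Data.Nat.Properties using (≤-trans; <⇒≤; ≰⇒>; <-irrefl; +-cancelʳ-≤; module ≤-Reasoning)
open import Data.Product using (∃; ∃₂; _×_; _,_)
open import Data.Sum using (_⊎_; inj₁; inj₂)
open import Function using (_∘_; Equivalence)
open import Relation.Binary.Definitions using (Reflexive; Symmetric)
open import Relation.Binary.PropositionalEquality
  using (_≡_; _≢_; refl; trans; cong; subst; setoid) renaming (sym to ≡-sym)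
open import Relation.Nullary using (¬_; Dec; yes; no; contradiction)
open import Relation.Nullary.Decidable using (toWitness; decidable-stable; _→-dec_)

-- Cyclic successors and lists.

next-inject₁ : ∀ {m} (j : Fin m) → next (inject₁ j) ≡ fs j
next-inject₁ {m} j with suc (toℕ (inject₁ j)) <? suc m
... | yes p = Fin.toℕ-injective (trans (Fin.toℕ-fromℕ< p) (cong suc (Fin.toℕ-inject₁ j)))
... | no ¬p = contradiction (s≤s (subst (_< m) (≡-sym (Fin.toℕ-inject₁ j)) (Fin.toℕ<n j))) ¬p

next-fromℕ : ∀ m → next (fromℕ m) ≡ fz
next-fromℕ m with suc (toℕ (fromℕ m)) <? suc m
... | yes p = contradiction p (<-irrefl (cong suc (Fin.toℕ-fromℕ m)))
... | no _  = refl

unique-resp-↭ : ∀ {A : Set} {xs ys : List A} → xs ↭ ys → Unique xs → Unique ys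
unique-resp-↭ p = Permutationₛ.Unique-resp-↭ (setoid _) (↭⇒↭ₛ p)

unique-++⁻ʳ : ∀ {A : Set} (xs : List A) {ys} → Unique (xs ++ ys) → Unique ys
unique-++⁻ʳ []       u       = u
unique-++⁻ʳ (_ ∷ xs) (_ ∷ u) = unique-++⁻ʳ xs u

-- Lets an induced copy be checked once per unordered pair: reflexivity supplies the diagonal,
-- symmetry the other order.
allPairs⇒related : ∀ {A : Set} {R : A → A → Set} → Reflexive R → Symmetric R →
  ∀ {xs} → AllPairs R xs → ∀ {a b} → a ∈ xs → b ∈ xs → R a b
allPairs⇒related rfl sm (_ ∷ _)  (here refl) (here refl) = rfl
allPairs⇒related rfl sm (r ∷ _)  (here refl) (there b∈)  = All.lookup r b∈
allPairs⇒related rfl sm (r ∷ _)  (there a∈)  (here refl) = sm (All.lookup r a∈)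
allPairs⇒related rfl sm (_ ∷ rs) (there a∈)  (there b∈)  = allPairs⇒related rfl sm rs a∈ b∈

-- Recognising induced copies of `P4` and `W`.

TwinFree : Graph → Set
TwinFree H = ∀ a b → (∀ c → adj H a c ≡ adj H b c) → a ≡ b

twinFree-P4 : TwinFree P4
twinFree-P4 = toWitness {a? = Fin.all? λ a → Fin.all? λ b →
  (Fin.all? λ c → adj P4 a c ≟ᵇ adj P4 b c) →-dec (a Fin.≟ b)} _

twinFree-W : TwinFree W
twinFree-W = toWitness {a? = Fin.all? λ a → Fin.all? λ b →
  (Fin.all? λ c → adj W a c ≟ᵇ adj W b c) →-dec (a Fin.≟ b)} _

-- An adjacency-preserving and -reflecting map identifies only twins, so injectivity is free.
inducedSub : ∀ {H G} → TwinFree H → (f : Vertex H → Vertex G) →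
  AllPairs (λ a b → adj H a b ≡ adj G (f a) (f b)) (tabulate (λ i → i)) → InducedSub H G
inducedSub {H} {G} tf f pairs = f , injective , same
  where
  same : ∀ a b → adj H a b ≡ adj G (f a) (f b)
  same a b = allPairs⇒related
    (λ {a} → trans (irrfl H a) (≡-sym (irrfl G (f a))))
    (λ {a} {b} e → trans (sym H b a) (trans e (sym G (f a) (f b))))
    pairs (∈-allFin a) (∈-allFin b)

  injective : ∀ {a b} → f a ≡ f b → a ≡ b
  injective {a} {b} e = tf a b λ c →
    trans (same a c) (trans (cong (λ w → adj G w (f c)) e) (≡-sym (same b c)))

module _ {G : Graph} where

  private
    V = Vertex G

  infix 4 _~_ _≁_

  _~_ : V → V → Set
  _~_ = Adj G

  _≁_ : V → V → Set
  a ≁ b = ¬ a ~ b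

  _~?_ : ∀ a b → Dec (a ~ b)
  a ~? b = T? (adj G a b)

  ~-sym : ∀ {a b} → a ~ b → b ~ a
  ~-sym {a} {b} = subst T (sym G a b)

  ~⇒≢ : ∀ {a b} → a ~ b → a ≢ b
  ~⇒≢ {a} a~a refl = subst T (irrfl G a) a~a

  edge : ∀ {a b} → a ~ b → true ≡ adj G a b
  edge = ≡-sym ∘ Equivalence.to T-≡

  nonEdge : ∀ {a b} → a ≁ b → false ≡ adj G a b
  nonEdge {a} {b} a≁b with adj G a b
  ... | true  = contradiction _ a≁b
  ... | false = refl

  inducedP4 : ∀ {a b c d} → a ~ b → b ~ c → c ~ d → a ≁ c → a ≁ d → b ≁ d → InducedSub P4 G
  inducedP4 {a} {b} {c} {d} ab bc cd ac ad bd =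
    inducedSub {P4} {G} twinFree-P4 (lookup (a ∷ b ∷ c ∷ d ∷ []))
      ( (edge ab ∷ nonEdge ac ∷ nonEdge ad ∷ [])
      ∷ (edge bc ∷ nonEdge bd ∷ [])
      ∷ (edge cd ∷ [])
      ∷ [] ∷ [])

  inducedW : ∀ {x a a′ b b′ c c′} →
    x ~ a → x ~ a′ → x ~ b → x ~ b′ → x ~ c → x ~ c′ → a ~ a′ → b ~ b′ → c ~ c′ →
    a ≁ b → a ≁ b′ → a′ ≁ b → a′ ≁ b′ →
    a ≁ c → a ≁ c′ → a′ ≁ c → a′ ≁ c′ →
    b ≁ c → b ≁ c′ → b′ ≁ c → b′ ≁ c′ → InducedSub W G
  inducedW {x} {a} {a′} {b} {b′} {c} {c′} xa xa′ xb xb′ xc xc′ aa′ bb′ cc′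
    ab ab′ a′b a′b′ ac ac′ a′c a′c′ bc bc′ b′c b′c′ =
    inducedSub {W} {G} twinFree-W (lookup (x ∷ a ∷ a′ ∷ b ∷ b′ ∷ c ∷ c′ ∷ []))
      ( (edge xa ∷ edge xa′ ∷ edge xb ∷ edge xb′ ∷ edge xc ∷ edge xc′ ∷ [])
      ∷ (edge aa′ ∷ nonEdge ab ∷ nonEdge ab′ ∷ nonEdge ac ∷ nonEdge ac′ ∷ [])
      ∷ (nonEdge a′b ∷ nonEdge a′b′ ∷ nonEdge a′c ∷ nonEdge a′c′ ∷ [])
      ∷ (edge bb′ ∷ nonEdge bc ∷ nonEdge bc′ ∷ [])
      ∷ (nonEdge b′c ∷ nonEdge b′c′ ∷ [])
      ∷ (edge cc′ ∷ [])
      ∷ [] ∷ [])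

  -- Paths and the cycles they close up to.

  -- The vertices of a path from a are a ∷ xs: the index lists those after the first.
  data Path (a : V) : List V → V → Set where
    []  : Path a [] a
    _∷_ : ∀ {b c xs} → a ~ b → Path b xs c → Path a (b ∷ xs) c

  join : ∀ {a b c d xs ys} → Path a xs b → b ~ c → Path c ys d → Path a (xs ++ c ∷ ys) d
  join []      e q = e ∷ q
  join (f ∷ p) e q = f ∷ join p e q

  -- The vertex list is tracked only up to permutation: detours use just its length, its members and
  -- their distinctness.
  reversed : ∀ {a b xs} → Path a xs b → ∃ λ ys → Path b ys a × b ∷ ys ↭ a ∷ xs
  reversed [] = [] , [] , ↭-refl
  reversed {a} {b} (e ∷ p) with reversed p
  ... | ys , q , π = ys ++ a ∷ [] , join q (~-sym e) [] , ↭-trans (++-comm (b ∷ ys) (a ∷ [])) (prep a π)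

  splitAfter : ∀ {a b y xs} → Path a xs b → y ∈ a ∷ xs →
    y ≡ b ⊎ (∃₂ λ as c → ∃ λ cs →
      Path a as y × y ~ c × Path c cs b × a ∷ xs ≡ (a ∷ as) ++ c ∷ cs)
  splitAfter []      (here refl) = inj₁ refl
  splitAfter (e ∷ p) (here refl) = inj₂ ([] , _ , _ , [] , e , p , refl)
  splitAfter {a} (_∷_ {b = b} e p) (there y∈) with splitAfter p y∈
  ... | inj₁ eq = inj₁ eq
  ... | inj₂ (as , c , cs , q , f , r , eq) = inj₂ (b ∷ as , c , cs , e ∷ q , f , r , cong (a ∷_) eq)

  tabulatePath : ∀ {m} (f : Fin (suc m) → V) → (∀ j → f (inject₁ j) ~ f (fs j)) →
    Path (f fz) (tabulate (f ∘ fs)) (f (fromℕ m))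
  tabulatePath {zero}  f e = []
  tabulatePath {suc m} f e = e fz ∷ tabulatePath (f ∘ fs) (e ∘ fs)

  lookup-adjacent : ∀ {a xs b} → Path a xs b → (j : Fin (length xs)) →
    lookup (a ∷ xs) (inject₁ j) ~ lookup (a ∷ xs) (fs j)
  lookup-adjacent (e ∷ p) fz     = e
  lookup-adjacent (e ∷ p) (fs j) = lookup-adjacent p j

  lookup-last : ∀ {a xs b} → Path a xs b → lookup (a ∷ xs) (fromℕ (length xs)) ≡ b
  lookup-last []      = refl
  lookup-last (e ∷ p) = lookup-last p

  lookup-injective : ∀ {xs : List V} → Unique xs → ∀ {i j} → lookup xs i ≡ lookup xs j → i ≡ j
  lookup-injective (_ ∷ _) {fz}   {fz}   _  = refl
  lookup-injective {_ ∷ xs} (h ∷ _) {fz}   {fs j} eq = contradiction eq (All.lookup h (∈-lookup {xs = xs} j))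
  lookup-injective {_ ∷ xs} (h ∷ _) {fs i} {fz}   eq = contradiction (≡-sym eq) (All.lookup h (∈-lookup {xs = xs} i))
  lookup-injective (_ ∷ u) {fs i} {fs j} eq = cong fs (lookup-injective u eq)

  cycleOf : ∀ {a xs b} → Path a xs b → b ~ a → Unique (a ∷ xs) → 3 ≤ suc (length xs) → Cycle G
  cycleOf {a} {xs} {b} p b~a u 3≤ = record
    { m = length xs ; len≥3 = 3≤ ; vert = lookup (a ∷ xs)
    ; distinct = lookup-injective u ; closed = close }
    where
    close : ∀ i → lookup (a ∷ xs) i ~ lookup (a ∷ xs) (next i)
    -- The top index wraps round to `fz` and takes the closing edge; every other index takes an edge
    -- of the path.
    close i with view i
    ... | ‵fromℕ rewrite next-fromℕ (length xs) = subst (_~ a) (≡-sym (lookup-last p)) b~a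
    ... | ‵inj₁ {i = j} _ rewrite next-inject₁ j = lookup-adjacent p j

  -- Cutting a cycle open.

  vertices : Cycle G → List V
  vertices C = tabulate (vert C)

  onCycle? : ∀ (C : Cycle G) v → Dec (OnCycle v C)
  onCycle? C v = Fin.any? λ i → vert C i Fin.≟ v

  onCycle⇒∈ : ∀ (C : Cycle G) {v} → OnCycle v C → v ∈ vertices C
  onCycle⇒∈ C (i , refl) = ∈-tabulate⁺ {f = vert C} i

  ∈⇒onCycle : ∀ (C : Cycle G) {v} → v ∈ vertices C → OnCycle v C
  ∈⇒onCycle C v∈ with ∈-tabulate⁻ v∈
  ... | i , eq = i , ≡-sym eq

  -- `C` cut open after `x`, with `a` as the successor of `x`. Only the vertex set of `C` is
  -- recorded, since every cycle on that set has the same length.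
  record Rotation (C : Cycle G) (x : V) : Set where
    constructor rotation
    field
      {a}  : V
      {as} : List V
      x~a  : x ~ a
      path : Path a as x
      perm : a ∷ as ↭ vertices C

  record Bisection (C : Cycle G) (x y : V) : Set where
    constructor bisection
    field
      {a b}   : V
      {as bs} : List V
      x~a     : x ~ a
      pathᵃ   : Path a as y
      y~b     : y ~ b
      pathᵇ   : Path b bs x
      perm    : (a ∷ as) ++ b ∷ bs ↭ vertices C

  vert-path : ∀ (C : Cycle G) → Path (vert C fz) (tabulate (vert C ∘ fs)) (vert C (fromℕ (m C)))
  vert-path C = tabulatePath (vert C) λ j →
    subst (λ i → vert C (inject₁ j) ~ vert C i) (next-inject₁ j) (closed C (inject₁ j))

  last~first : ∀ (C : Cycle G) → vert C (fromℕ (m C)) ~ vert C fz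
  last~first C = subst (λ i → vert C (fromℕ (m C)) ~ vert C i) (next-fromℕ (m C)) (closed C (fromℕ (m C)))

  rotate : ∀ (C : Cycle G) {x} → OnCycle x C → Rotation C x
  rotate C x∈C with splitAfter (vert-path C) (onCycle⇒∈ C x∈C)
  ... | inj₁ refl = rotation (last~first C) (vert-path C) ↭-refl
  ... | inj₂ (as , c , cs , p , x~c , q , eq) = rotation x~c (join q (last~first C) p)
    (↭-trans (++-comm (c ∷ cs) (vert C fz ∷ as)) (↭-reflexive (≡-sym eq)))

  bisect : ∀ {C : Cycle G} {x y} → OnCycle x C → OnCycle y C → y ≢ x → Bisection C x y
  bisect {C} x∈C y∈C y≢x with rotate C x∈C
  ... | rotation x~a p π with splitAfter p (∈-resp-↭ (↭-sym π) (onCycle⇒∈ C y∈C))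
  ...   | inj₁ eq = contradiction eq y≢x
  ...   | inj₂ (_ , _ , _ , q , y~b , r , refl) = bisection x~a q y~b r π

  -- Detours off a longest cycle.

  module _ (P4-free : ¬ InducedSub P4 G) (C : Cycle G) (longest : LongestCycle G C) where

    Off : V → Set
    Off v = ¬ OnCycle v C

    closed-path≤len : ∀ {a xs b} → Path a xs b → b ~ a → Unique (a ∷ xs) → length (a ∷ xs) ≤ len C
    closed-path≤len {a} {xs} p b~a u with 3 ≤? length (a ∷ xs)
    ... | yes 3≤ = longest (cycleOf p b~a u 3≤)
    -- Fewer than three vertices form no cycle, but `C` has at least three.
    ... | no 3≰  = ≤-trans (<⇒≤ (≰⇒> 3≰)) (len≥3 C)

    -- Closing up c ∷ cs with the new path trades the vertices zs of C for p ∷ ps.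
    detour : ∀ {x c cs p ps q} zs → Path c cs x → zs ++ c ∷ cs ↭ vertices C →
      Path p ps q → Unique (p ∷ ps) → All Off (p ∷ ps) → x ~ p → q ~ c →
      length (p ∷ ps) ≤ length zs
    detour {c = c} {cs} {p} {ps} zs path π new unique-new off x~p q~c =
      +-cancelʳ-≤ (length (c ∷ cs)) _ _ (begin
        length (p ∷ ps) + length (c ∷ cs)  ≡⟨ length-++ (p ∷ ps) ⟨
        length (p ∷ ps ++ c ∷ cs)          ≤⟨ closed-path≤len (join new q~c path) x~p unique ⟩
        len C                              ≡⟨ length-tabulate (vert C) ⟨
        length (vertices C)                ≡⟨ ↭-length π ⟨
        length (zs ++ c ∷ cs)              ≡⟨ length-++ zs ⟩
        length zs + length (c ∷ cs)        ∎)
      where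
      open ≤-Reasoning
      disjoint : Disjoint (p ∷ ps) (c ∷ cs)
      disjoint (v∈new , v∈old) =
        All.lookup off v∈new (∈⇒onCycle C (∈-resp-↭ π (∈-++⁺ʳ zs v∈old)))
      unique : Unique (p ∷ ps ++ c ∷ cs)
      unique = Unique.++⁺ unique-new
        (unique-++⁻ʳ zs (unique-resp-↭ (↭-sym π) (Unique.tabulate⁺ (distinct C)))) disjoint

    -- Otherwise p x a b would be an induced P₄.
    extend-star : ∀ {x p a b} → x ~ p → x ~ a → a ~ b → p ≁ a → p ≁ b → x ~ b
    extend-star {x} {b = b} x~p x~a a~b p≁a p≁b = decidable-stable (x ~? b)
      λ x≁b → P4-free (inducedP4 (~-sym x~p) x~a a~b p≁a p≁b x≁b)

    -- Inserting `p` between `x` and `c` would gain a vertex and drop none.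
    detour₁ : ∀ {x c cs p} → Path c cs x → c ∷ cs ↭ vertices C → Off p → x ~ p → p ≁ c
    detour₁ path π off x~p p~c
      with () ← detour [] path π [] ([] ∷ []) (off ∷ []) x~p p~c

    -- The detour `x p q c` would gain two vertices and drop at most one.
    detour₂ : ∀ {x c cs p q} zs → length zs < 2 → Path c cs x → zs ++ c ∷ cs ↭ vertices C →
      Off p → Off q → p ~ q → x ~ p → q ≁ c
    detour₂ zs short path π off off′ p~q x~p q~c = <-irrefl refl (≤-trans short
      (detour zs path π (p~q ∷ []) ((~⇒≢ p~q ∷ []) ∷ [] ∷ []) (off ∷ off′ ∷ []) x~p q~c))

    -- Let `a` follow `x` on the cycle. Detours exclude the edges `ap` and `aq`, so `x ≁ q` would
    -- make `a x p q` an induced `P4`.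
    attached-edge : ∀ {x p q} → OnCycle x C → Off p → Off q → p ~ q → x ~ p → x ~ q
    attached-edge x∈C off off′ p~q x~p with rotate C x∈C
    ... | rotation x~a path π =
      extend-star x~a x~p p~q (detour₁ path π off x~p ∘ ~-sym)
        (detour₂ [] (s≤s z≤n) path π off off′ p~q x~p ∘ ~-sym)

    -- The first vertex of `C` on the walk is adjacent to its predecessor there, and `attached-edge`
    -- carries this adjacency back to `w`. Keeping `ok x` allows a prescribed vertex to be avoided.
    attachment : ∀ {ok w z} → Walk G ok w z → Off w → OnCycle z C →
      ∃ λ x → OnCycle x C × ok x × x ~ w
    attachment (here _) off on = contradiction on off
    attachment (step {w = w′} _ w~w′ walk) off on with onCycle? C w′
    -- The rest of the walk is opened only to read off `ok w′`.
    attachment (step _ w~w′ (here ok)) off on       | yes on′ = _ , on′ , ok , ~-sym w~w′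
    attachment (step _ w~w′ (step ok _ _)) off on   | yes on′ = _ , on′ , ok , ~-sym w~w′
    attachment (step _ w~w′ walk) off on            | no off′ with attachment walk off′ on
    ... | x , x∈C , okˣ , x~w′ = x , x∈C , okˣ , attached-edge x∈C off′ off (~-sym w~w′) x~w′

    -- An edge `uv` missing the cycle.

    module _ {u v} (off-u : Off u) (off-v : Off v) (u~v : u ~ v) where

      -- Reversing the first arc gives `y … a b … x`, which `x u v y` would close up, gaining two
      -- vertices and dropping only `zs`.
      no-chord : ∀ {x y a b as bs} zs → length zs < 2 → x ~ u → y ~ v →
        Path a as y → Path b bs x → zs ++ (a ∷ as) ++ b ∷ bs ↭ vertices C → a ≁ b
      no-chord {b = b} {bs = bs} zs short x~u y~v p q π a~b with reversed p
      ... | ys , p′ , ρ = detour₂ zs short (join p′ a~b q) (↭-trans (++⁺ˡ zs (++⁺ʳ (b ∷ bs) ρ)) π)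
        off-u off-v u~v x~u (~-sym y~v)

      -- An edge to `a` allows a one-vertex detour dropping nothing; an edge to `a′` allows a detour
      -- through both `u` and `v` dropping only `a`.
      unattached : ∀ {x a a′ as} → x ~ u → x ~ v → a ~ a′ → Path a′ as x →
        a ∷ a′ ∷ as ↭ vertices C → u ≁ a × v ≁ a × u ≁ a′ × v ≁ a′
      unattached {a = a} x~u x~v a~a′ p π =
        detour₁ (a~a′ ∷ p) π off-u x~u , detour₁ (a~a′ ∷ p) π off-v x~v ,
        detour₂ (a ∷ []) (s≤s (s≤s z≤n)) p π off-v off-u (~-sym u~v) x~v ,
        detour₂ (a ∷ []) (s≤s (s≤s z≤n)) p π off-u off-v u~v x~u

      module _ {x y} (x~u : x ~ u) (x~v : x ~ v) (y~u : y ~ u) (y~v : y ~ v) where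

        W-at-x : ∀ {a a′ as b b′ bs} →
          x ~ a → a ~ a′ → Path a′ as y → y ~ b → b ~ b′ → Path b′ bs x →
          (a ∷ a′ ∷ as) ++ b ∷ b′ ∷ bs ↭ vertices C → x ~ b → InducedSub W G
        W-at-x {a} {a′} {as} {b} {b′} {bs} x~a a~a′ p y~b b~b′ q π x~b
          with unattached x~u x~v a~a′ (join p y~b (b~b′ ∷ q)) π
             | unattached y~u y~v b~b′ (join q x~a (a~a′ ∷ p)) (↭-trans (++-comm (b ∷ b′ ∷ bs) (a ∷ a′ ∷ as)) π)
        ... | u≁a , v≁a , u≁a′ , v≁a′ | u≁b , v≁b , u≁b′ , v≁b′ =
          inducedW x~u x~v x~a (extend-star x~u x~a a~a′ u≁a u≁a′) x~b (extend-star x~u x~b b~b′ u≁b u≁b′)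
            u~v a~a′ b~b′ u≁a u≁a′ v≁a v≁a′ u≁b u≁b′ v≁b v≁b′
            a≁b a≁b′ a′≁b
            -- A detour using `a′b′` would drop both `a` and `b` and gain no length, so this pair is
            -- excluded by the induced path `a a′ b′ b` instead.
            λ a′~b′ → P4-free (inducedP4 a~a′ a′~b′ (~-sym b~b′) a≁b′ a≁b a′≁b)
          where
          a≁b : a ≁ b
          a≁b = no-chord [] (s≤s z≤n) x~u y~v (a~a′ ∷ p) (b~b′ ∷ q) π
          a≁b′ : a ≁ b′
          a≁b′ = no-chord (b ∷ []) (s≤s (s≤s z≤n)) x~u y~v (a~a′ ∷ p) q
            (↭-trans (↭-sym (shift b (a ∷ a′ ∷ as) (b′ ∷ bs))) π)
          a′≁b : a′ ≁ b
          a′≁b = no-chord (a ∷ []) (s≤s (s≤s z≤n)) x~u y~v p (b~b′ ∷ q) π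

        -- Otherwise there is an induced `P4`: `a x y b` if `x ~ y`, and `x u y b` if not.
        successor-adjacent-to-other : ∀ {a a′ b b′ as bs} →
          x ~ a → a ~ a′ → Path a′ as y → y ~ b → b ~ b′ → Path b′ bs x →
          (a ∷ a′ ∷ as) ++ b ∷ b′ ∷ bs ↭ vertices C → ¬ (x ≁ b × y ≁ a)
        successor-adjacent-to-other {a} {a′} {b} {b′} {as} {bs} x~a a~a′ p y~b b~b′ q π (x≁b , y≁a) with x ~? y
        ... | yes x~y = P4-free (inducedP4 (~-sym x~a) x~y y~b (y≁a ∘ ~-sym)
          (no-chord [] (s≤s z≤n) x~u y~v (a~a′ ∷ p) (b~b′ ∷ q) π) x≁b)
        ... | no x≁y = P4-free (inducedP4 x~u (~-sym y~u) y~b x≁y x≁b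
          (detour₁ (join (b~b′ ∷ q) x~a (a~a′ ∷ p)) (↭-trans (++-comm (b ∷ b′ ∷ bs) (a ∷ a′ ∷ as)) π) off-u y~u))

      two-attachments⇒W : ∀ {x y} → OnCycle x C → OnCycle y C → y ≢ x →
        x ~ u → x ~ v → y ~ u → y ~ v → InducedSub W G
      two-attachments⇒W {x} {y} x∈C y∈C y≢x x~u x~v y~u y~v = go (bisect x∈C y∈C y≢x)
        where
        go : Bisection C x y → InducedSub W G
        -- If an arc is a single vertex, `x` and `y` are consecutive and `u` fits between them.
        -- Hence both arcs have a second vertex.
        go (bisection _ [] y~b q π) = contradiction (~-sym y~u) (detour₁ (y~b ∷ q) π off-u x~u)
        go (bisection {as = as} x~a p@(_ ∷ _) _ [] π) = contradiction (~-sym x~u)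
          (detour₁ (x~a ∷ p) (↭-trans (++-comm (x ∷ []) (_ ∷ as)) π) off-u y~u)
        go (bisection {a} {b} {as} {bs} x~a (a~a′ ∷ p) y~b (b~b′ ∷ q) π) with x ~? b | y ~? a
        ... | yes x~b | _ = W-at-x x~u x~v y~u y~v x~a a~a′ p y~b b~b′ q π x~b
        -- The mirror case: `x` and `y` swap roles, and so do the arcs.
        ... | no _ | yes y~a = W-at-x y~u y~v x~u x~v y~b b~b′ q x~a a~a′ p
          (↭-trans (++-comm (b ∷ bs) (a ∷ as)) π) y~a
        ... | no x≁b | no y≁a =
          contradiction (x≁b , y≁a) (successor-adjacent-to-other x~u x~v y~u y~v x~a a~a′ p y~b b~b′ q π)

-- Two attachments from 2-connectedness.

theorem4 : (G : Graph) → TwoConnected G → P4WFree G →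
    (C : Cycle G) → LongestCycle G C → Dominating G C
theorem4 G (_ , connected , robust) (P4-free , W-free) C longest u v u~v
  with onCycle? C u | onCycle? C v
... | yes u∈C | _       = inj₁ u∈C
... | no _    | yes v∈C = inj₂ v∈C
... | no off-u | no off-v
  with attachment P4-free C longest (connected u (vert C fz)) off-u (fz , refl)
... | x , x∈C@(i , refl) , _ , x~u
  with attachment P4-free C longest
         -- The successor of `x` is a vertex of `C` other than `x`, so a walk to it from `u`
         -- avoiding `x` yields an attachment `y ≢ x`.
         (robust x u (vert C (next i)) (~⇒≢ {G} x~u ∘ ≡-sym) (~⇒≢ {G} (closed C i) ∘ ≡-sym))
         off-u (next i , refl)
... | y , y∈C , y≢x , y~u =
  contradiction
    (two-attachments⇒W P4-free C longest off-u off-v u~v x∈C y∈C y≢x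
      x~u (attached-edge P4-free C longest x∈C off-u off-v u~v x~u)
      y~u (attached-edge P4-free C longest y∈C off-u off-v u~v y~u))
    W-free
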